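{- The number $R_3(L)$ satisfies $R_3(L) \leq 772$.
   Context: For a positive integer $n$, the $n \times n$ integer grid is $[n]\times[n]=\{(i,j): 1\le i,j\le n\}$, where $(i,j)$ is the point in row $i$ (rows counted downward) and column $j$ (columns counted left to right). Given a coloring of $[n]\times[n]$ with $k$ colors (an arbitrary map from $[n]\times[n]$ to a set of $k$ colors), a monochromatic $L$ is a set of three points $\{(x,y),(x+d,y),(x+d,y+d)\}\subseteq [n]\times[n]$, with $d$ a positive integer, all having the same color. For a positive integer $k$, $R_k(L)$ denotes the least positive integer $n$ such that every $k$-coloring of $[n]\times[n]$ contains a monochromatic $L$ (it exists by the Gallai-Witt theorem). -}

module Defs where

open import Data.Nat using (ℕ; _+_; _≤_; _<_)
open import Data.Fin using (Fin; toℕ)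
open import Relation.Binary.PropositionalEquality using (_≡_)

-- Rows and columns are numbered 0, …, n − 1 rather than 1, …, n: the point
-- (i , j) of [n] × [n] is represented by the indices with values i − 1, j − 1.
-- The notion of an L below is invariant under this shift.
Coloring : ℕ → ℕ → Set
Coloring k n = Fin n → Fin n → Fin k

-- The three points are (x , y), (x′ , y) = (x + d , y) and
-- (x′ , y′) = (x + d , y + d); being indices in Fin n, they lie in the grid.
record MonochromaticL {k n : ℕ} (c : Coloring k n) : Set where
  field
    x x′ y y′  : Fin n
    d          : ℕ
    d-positive : 0 < d
    x′≡x+d     : toℕ x′ ≡ toℕ x + d
    y′≡y+d     : toℕ y′ ≡ toℕ y + d
    color₁₂    : c x y ≡ c x′ y
    color₂₃    : c x′ y ≡ c x′ y′

EveryColoringHasL : ℕ → ℕ → Set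
EveryColoringHasL k n = (c : Coloring k n) → MonochromaticL c

-- The number R_k(L) is introduced through its graph, n being uniquely determined by k;
-- as a total function of k it would presuppose the Gallai–Witt theorem.
record IsR (k n : ℕ) : Set where
  field
    positive : 0 < n
    forces   : EveryColoringHasL k n
    least    : ∀ m → 0 < m → EveryColoringHasL k m → n ≤ m

{-# OPTIONS --safe #-}
module Submission where

-- Some color r occurs at least 258 times on the main diagonal. Counting pairs in windows
-- of length 50 gives a difference h realized by 77 pairs of these points, so that 39 points
-- (t + h , t), with (t , t) and (t + h , t + h) of color r, share a second color. Counting
-- pairs in windows of length 60, the 39 values t are too many to have distinct differences.
-- For any two of them, t < t + δ, the point (t + δ + h , t) must have the third color, so a
-- repeated difference places an L among points of this kind. The least n exists
-- constructively because it is decidable whether every k-coloring contains an L.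

open import Data.Nat using (ℕ; zero; suc; _+_; _*_; _∸_; _^_; _≤_; _<_; z≤n; s≤s; z<s; _<?_; _≟_)
open import Data.Nat.Properties hiding (_<?_; _≟_)
open import Data.Nat.Tactic.RingSolver using (solve-∀)
open import Data.Fin using (Fin; zero; suc; toℕ; fromℕ<; punchIn; punchOut; funToFin; finToFun)
import Data.Fin.Properties as Fin
open import Data.Product using (_×_; _,_; ∃-syntax; proj₁)
open import Data.Sum using (inj₁; inj₂)
open import Data.Unit using (tt)
open import Function using (_∘_)
open import Relation.Binary.Definitions using (tri<; tri≈; tri>)
open import Relation.Binary.PropositionalEquality
  using (_≡_; _≢_; refl; sym; trans; cong; cong₂; subst; module ≡-Reasoning)
open import Relation.Nullary using (¬_; Dec; yes; no; contradiction; _×-dec_)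
open import Relation.Nullary.Decidable using (decidable-stable; map′)
open import Algebra.Properties.Semiring.Sum +-*-semiring
  using (sum; sum-cong-≗; sum-remove; ∑-distrib-+; ∑-comm; *-distribˡ-sum; *-distribʳ-sum)
open import Defs

-- Finite sums and pigeonhole

Σ< : ℕ → (ℕ → ℕ) → ℕ
Σ< n f = sum {n} (λ i → f (toℕ i))

sum-mono : ∀ {n} {f g : Fin n → ℕ} → (∀ i → f i ≤ g i) → sum f ≤ sum g
sum-mono {zero}  f≤g = z≤n
sum-mono {suc n} f≤g = +-mono-≤ (f≤g zero) (sum-mono (f≤g ∘ suc))

sum-const : ∀ n c → sum {n} (λ _ → c) ≡ n * c
sum-const zero    c = refl
sum-const (suc n) c = cong (c +_) (sum-const n c)

pigeonhole-sum : ∀ {n} (f : Fin n → ℕ) m → n * m < sum f → ∃[ i ] m < f i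
pigeonhole-sum {n} f m nm<Σ with Fin.any? (λ i → m <? f i)
... | yes p = p
... | no ¬p = contradiction nm<Σ (≤⇒≯ (≤-trans
  (sum-mono (λ i → ≮⇒≥ (λ m<f → ¬p (i , m<f)))) (≤-reflexive (sum-const n m))))

Σ<-vanish : ∀ M i f → (∀ t → M ≤ t → f t ≡ 0) → Σ< (M + i) f ≡ Σ< M f
Σ<-vanish zero    zero    f f0 = refl
Σ<-vanish zero    (suc i) f f0 =
  cong₂ _+_ (f0 0 z≤n) (Σ<-vanish zero i (f ∘ suc) (λ t _ → f0 (suc t) z≤n))
Σ<-vanish (suc M) i       f f0 =
  cong (f 0 +_) (Σ<-vanish M i (f ∘ suc) (λ t M≤t → f0 (suc t) (s≤s M≤t)))

-- Terms are at most 1, so a total above 1 cannot come from a single index. Applied to the starts of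
-- pairs with a fixed difference, it yields two such pairs.
two-positive : ∀ n f → (∀ t → f t ≤ 1) → 1 < Σ< n f →
               ∃[ t ] ∃[ e ] (0 < e × 0 < f t × 0 < f (t + e))
two-positive (suc n) f f≤1 1<Σ with f 0 in f0
... | suc _ = let k , 0<fk = pigeonhole-sum {n} (λ i → f (suc (toℕ i))) 0 pos
              in 0 , suc (toℕ k) , z<s , subst (0 <_) (sym f0) z<s , 0<fk
  where
  pos : n * 0 < Σ< n (f ∘ suc)
  pos rewrite *-zeroʳ n with s≤s z≤n ← subst (_≤ 1) f0 (f≤1 0) = ≤-pred 1<Σ
... | zero =
  let t , e , 0<e , p , q = two-positive n (f ∘ suc) (f≤1 ∘ suc) 1<Σ
  in suc t , e , 0<e , p , q

-- Sliding windows and popular differences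

-- Delaying f by w lets the windows of length at most w overhang the start of its support.
delay : ℕ → (ℕ → ℕ) → ℕ → ℕ
delay zero    f t       = f t
delay (suc w) f zero    = 0
delay (suc w) f (suc t) = delay w f t

delay-+ : ∀ k i f t → delay (i + k) f (t + i) ≡ delay k f t
delay-+ k zero    f t rewrite +-identityʳ t = refl
delay-+ k (suc i) f t rewrite +-suc t i = delay-+ k i f t

Σ<-delay : ∀ k n f → Σ< (k + n) (delay k f) ≡ Σ< n f
Σ<-delay zero    n f = refl
Σ<-delay (suc k) n f = Σ<-delay k n f

delay-* : ∀ w f h t → delay w f t * delay w f (t + h) ≤ delay w (λ u → f u * f (u + h)) t
delay-* zero    f h t       = ≤-refl
delay-* (suc w) f h zero    = z≤n
delay-* (suc w) f h (suc t) = delay-* w f h t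

-- `delay` moves the support from [0, N) to [w, w + N), and for i ≤ w the positions t + i with t < N
-- + w cover it. Each fixed offset in the window thus sees every point once.
Σ<-delay-window : ∀ N w i f → i ≤ w → (∀ t → N ≤ t → f t ≡ 0) →
                  Σ< (N + w) (λ t → delay w f (t + i)) ≡ Σ< N f
Σ<-delay-window N w i f i≤w f0 with k , refl ← m≤n⇒∃[o]m+o≡n i≤w = begin
  Σ< (N + (i + k)) (λ t → delay (i + k) f (t + i)) ≡⟨ sum-cong-≗ {N + (i + k)} (λ t → delay-+ k i f (toℕ t)) ⟩
  Σ< (N + (i + k)) (delay k f)                     ≡⟨ cong (λ n → Σ< n (delay k f)) (rearrange N i k) ⟩
  Σ< (k + (N + i)) (delay k f)                     ≡⟨ Σ<-delay k (N + i) f ⟩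
  Σ< (N + i) f                                     ≡⟨ Σ<-vanish N i f f0 ⟩
  Σ< N f                                           ∎
  where
  open ≡-Reasoning
  rearrange : ∀ N i k → N + (i + k) ≡ k + (N + i)
  rearrange = solve-∀

-- The tangent at m + ½ to the parabola c², scaled so that it touches at c = m and c = m + 1.
tangent : ∀ m c → suc (2 * m) * c ≤ c * c + m * suc m
tangent m c with ≤-total c m
-- The slack is (c - m)(c - m - 1), a product of consecutive integers and so nonnegative.
... | inj₁ c≤m with k , refl ← m≤n⇒∃[o]m+o≡n c≤m = m+n≤o⇒m≤o _ (≤-reflexive (below c k))
  where
  below : ∀ c k → suc (2 * (c + k)) * c + k * suc k ≡ c * c + (c + k) * suc (c + k)
  below = solve-∀
... | inj₂ m≤c with m≤n⇒∃[o]m+o≡n m≤c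
...   | zero  , refl = ≤-reflexive (at m)
  where
  at : ∀ m → suc (2 * m) * (m + 0) ≡ (m + 0) * (m + 0) + m * suc m
  at = solve-∀
...   | suc k , refl = m+n≤o⇒m≤o _ (≤-reflexive (above m k))
  where
  above : ∀ m k → suc (2 * m) * (m + suc k) + k * suc k ≡ (m + suc k) * (m + suc k) + m * suc m
  above = solve-∀

-- With both offsets fixed, a pair determines the window start that hits it, so each pair with
-- difference h is counted at most once.
Σ<-delay-corr : ∀ N w i h f → i ≤ w → (∀ t → N ≤ t → f t ≡ 0) →
  Σ< (N + w) (λ t → delay w f (t + i) * delay w f (t + (i + h))) ≤ Σ< N (λ t → f t * f (t + h))
Σ<-delay-corr N w i h f i≤w f0 = begin
  Σ< (N + w) (λ t → delay w f (t + i) * delay w f (t + (i + h)))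
    ≤⟨ sum-mono {N + w} (λ t → subst (λ u → delay w f (toℕ t + i) * delay w f u ≤ delay w g (toℕ t + i))
                                (+-assoc (toℕ t) i h) (delay-* w f h (toℕ t + i))) ⟩
  Σ< (N + w) (λ t → delay w g (t + i))
    ≡⟨ Σ<-delay-window N w i g i≤w (λ t N≤t → cong (_* f (t + h)) (f0 t N≤t)) ⟩
  Σ< N g ∎
  where
  open ≤-Reasoning
  g : ℕ → ℕ
  g t = f t * f (t + h)

sum-square : ∀ {n} (a : Fin n → ℕ) → sum a * sum a ≡ sum (λ i → sum (λ j → a i * a j))
sum-square a = trans (*-distribʳ-sum (sum a) a) (sum-cong-≗ (λ i → *-distribˡ-sum (a i) a))

sum-pairs : ∀ v (A : Fin (suc v) → Fin (suc v) → ℕ) s T →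
            (∀ i → A i i ≤ s) → (∀ i j → i ≢ j → A i j ≤ T) →
            sum (λ i → sum (A i)) ≤ suc v * (s + v * T)
sum-pairs v A s T diagonal off-diagonal = begin
  sum (λ i → sum (A i))             ≤⟨ sum-mono row ⟩
  sum {suc v} (λ _ → s + v * T)     ≡⟨ sum-const (suc v) (s + v * T) ⟩
  suc v * (s + v * T)               ∎
  where
  open ≤-Reasoning
  row : ∀ i → sum (A i) ≤ s + v * T
  row i = begin
    sum (A i)                                     ≡⟨ sum-remove (A i) ⟩
    A i i + sum {v} (λ j → A i (punchIn i j))     ≤⟨ +-mono-≤ (diagonal i) (sum-mono (λ j →
                                                       off-diagonal i _ (Fin.punchInᵢ≢i i j ∘ sym))) ⟩
    s + sum {v} (λ _ → T)                         ≡⟨ cong (s +_) (sum-const v T) ⟩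
    s + v * T                                     ∎

-- Let c t be the number of points in the window of length w = suc v at t. If each
-- positive difference below w occurred at most T times, then ∑ c² would be at most
-- w (s + v T), whereas ∑ c = w s and the tangent bound force it to be larger.
-- The best m is the integer part of the mean of c.
popular-difference : ∀ N v m T s₀ (f : ℕ → ℕ) →
  (∀ t → f t ≤ 1) → (∀ t → N ≤ t → f t ≡ 0) → s₀ ≤ Σ< N f →
  (N + suc v) * (m * suc m) + suc v * (v * T) < 2 * m * (suc v * s₀) →
  ∃[ h ] (0 < h × T < Σ< N (λ t → f t * f (t + h)))
popular-difference N v m T s₀ f f≤1 f0 s₀≤s gap
  with Fin.any? (λ (k : Fin v) → T <? Σ< N (λ t → f t * f (t + suc (toℕ k))))
... | yes (k , T<D) = suc (toℕ k) , z<s , T<D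
-- Adding `w * s` to both sides turns 2m into the slope 2m + 1 and absorbs the diagonal part of the
-- second moment.
... | no ¬popular = contradiction gap (≤⇒≯ (+-cancelˡ-≤ (w * s) _ _ (begin
  w * s + 2 * m * (w * s₀)                ≤⟨ +-monoʳ-≤ (w * s) (*-monoʳ-≤ (2 * m) (*-monoʳ-≤ w s₀≤s)) ⟩
  suc (2 * m) * (w * s)                   ≡⟨ cong (suc (2 * m) *_) first-moment ⟨
  suc (2 * m) * Σ< W c                    ≡⟨ *-distribˡ-sum {W} (suc (2 * m)) (c ∘ toℕ) ⟩
  Σ< W (λ t → suc (2 * m) * c t)          ≤⟨ sum-mono {W} (λ t → tangent m (c (toℕ t))) ⟩
  Σ< W (λ t → c t * c t + m * suc m)      ≡⟨ ∑-distrib-+ {W} (λ t → c (toℕ t) * c (toℕ t)) (λ _ → m * suc m) ⟩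
  Σ< W (λ t → c t * c t) + Σ< W (λ _ → m * suc m)
                                          ≤⟨ +-mono-≤ second-moment (≤-reflexive (sum-const W (m * suc m))) ⟩
  w * (s + v * T) + W * (m * suc m)       ≡⟨ regroup w s (v * T) (W * (m * suc m)) ⟩
  w * s + (W * (m * suc m) + w * (v * T)) ∎)))
  where
  open ≤-Reasoning
  w W s : ℕ
  w = suc v
  W = N + w
  s = Σ< N f
  p c : ℕ → ℕ
  p = delay w f
  c t = Σ< w (λ i → p (t + i))

  regroup : ∀ w s x y → w * (s + x) + y ≡ w * s + (y + w * x)
  regroup = solve-∀

  toℕ≤w : (i : Fin w) → toℕ i ≤ w
  toℕ≤w i = <⇒≤ (Fin.toℕ<n i)

  first-moment : Σ< W c ≡ w * s
  first-moment = trans (∑-comm {W} {w} (λ t i → p (toℕ t + toℕ i))) (trans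
    (sum-cong-≗ {w} (λ i → Σ<-delay-window N w (toℕ i) f (toℕ≤w i) f0)) (sum-const w s))

  corr : ℕ → ℕ → ℕ
  corr i j = Σ< W (λ t → p (t + i) * p (t + j))

  corr-diagonal : ∀ i → i ≤ w → corr i i ≤ s
  corr-diagonal i i≤w = begin
    corr i i                    ≡⟨ cong (corr i) (+-identityʳ i) ⟨
    corr i (i + 0)              ≤⟨ Σ<-delay-corr N w i 0 f i≤w f0 ⟩
    Σ< N (λ t → f t * f (t + 0))
                                ≤⟨ sum-mono {N} (λ t → m≤1⇒k*m≤k (f (toℕ t)) (f≤1 (toℕ t + 0))) ⟩
    s                           ∎
    where
    m≤1⇒k*m≤k : ∀ k {m} → m ≤ 1 → k * m ≤ k
    m≤1⇒k*m≤k k m≤1 = ≤-trans (*-monoʳ-≤ k m≤1) (≤-reflexive (*-identityʳ k))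

  corr-< : ∀ i j → i < j → j < w → corr i j ≤ T
  corr-< i j i<j (s≤s j≤v) with h , refl ← m≤n⇒∃[o]m+o≡n i<j =
    subst (λ u → corr i u ≤ T) (+-suc i h) (≤-trans
      (Σ<-delay-corr N w i (suc h) f (≤-trans (<⇒≤ i<j) (m≤n⇒m≤1+n j≤v)) f0)
      (≮⇒≥ (λ T<D → ¬popular (fromℕ< h<v , subst (λ u → T < Σ< N (λ t → f t * f (t + suc u)))
                                            (sym (Fin.toℕ-fromℕ< h<v)) T<D))))
    where
    h<v : h < v
    h<v = ≤-trans (s≤s (m≤n+m h i)) j≤v

  corr-≢ : (i j : Fin w) → i ≢ j → corr (toℕ i) (toℕ j) ≤ T
  corr-≢ i j i≢j with <-cmp (toℕ i) (toℕ j)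
  ... | tri< i<j _ _ = corr-< (toℕ i) (toℕ j) i<j (Fin.toℕ<n j)
  ... | tri≈ _ i≡j _ = contradiction (Fin.toℕ-injective i≡j) i≢j
  ... | tri> _ _ j<i = subst (_≤ T)
    (sum-cong-≗ {W} (λ t → *-comm (p (toℕ t + toℕ j)) (p (toℕ t + toℕ i))))
    (corr-< (toℕ j) (toℕ i) j<i (Fin.toℕ<n i))

  -- Expanding the square and summing over window starts first leaves one correlation for each
  -- ordered pair of offsets; for distinct offsets it is bounded by the count of a difference from 1
  -- to v.
  second-moment : Σ< W (λ t → c t * c t) ≤ w * (s + v * T)
  second-moment = begin
    Σ< W (λ t → c t * c t)
      ≡⟨ sum-cong-≗ {W} (λ t → sum-square {w} (λ i → p (toℕ t + toℕ i))) ⟩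
    Σ< W (λ t → Σ< w (λ i → Σ< w (λ j → p (t + i) * p (t + j))))
      ≡⟨ ∑-comm {W} {w} (λ t i → Σ< w (λ j → p (toℕ t + toℕ i) * p (toℕ t + j))) ⟩
    Σ< w (λ i → Σ< W (λ t → Σ< w (λ j → p (t + i) * p (t + j))))
      ≡⟨ sum-cong-≗ {w} (λ i → ∑-comm {W} {w} (λ t j → p (toℕ t + toℕ i) * p (toℕ t + toℕ j))) ⟩
    Σ< w (λ i → Σ< w (λ j → corr i j))
      ≤⟨ sum-pairs v (λ i j → corr (toℕ i) (toℕ j)) s T
           (λ i → corr-diagonal (toℕ i) (toℕ≤w i)) corr-≢ ⟩
    w * (s + v * T) ∎

-- Indicators, color classes and points of the grid

𝟙 : ∀ {P : Set} → Dec P → ℕ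
𝟙 (yes _) = 1
𝟙 (no  _) = 0

𝟙≤1 : ∀ {P : Set} (P? : Dec P) → 𝟙 P? ≤ 1
𝟙≤1 (yes _) = ≤-refl
𝟙≤1 (no  _) = z≤n

𝟙-no : ∀ {P : Set} (P? : Dec P) → ¬ P → 𝟙 P? ≡ 0
𝟙-no (yes p) ¬p = contradiction p ¬p
𝟙-no (no  _) _  = refl

𝟙-yes : ∀ {P : Set} (P? : Dec P) → P → 1 ≤ 𝟙 P?
𝟙-yes (yes _) _ = ≤-refl
𝟙-yes (no ¬p) p = contradiction p ¬p

term≤sum : ∀ {n} (f : Fin n → ℕ) i → f i ≤ sum f
term≤sum f zero    = m≤m+n _ _
term≤sum f (suc i) = ≤-trans (term≤sum (f ∘ suc) i) (m≤n+m _ _)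

-- Exchanging the sums distributes the total of `g` over the k classes. It serves first for three
-- colors on the diagonal, then for two colors below it.
popular-class : ∀ N k m (g : ℕ → ℕ) (F : Fin k → ℕ → ℕ) →
  (∀ t → t < N → g t ≤ sum (λ a → F a t)) → k * m < Σ< N g → ∃[ a ] m < Σ< N (F a)
popular-class N k m g F g≤ΣF km<Σg = pigeonhole-sum (λ a → Σ< N (F a)) m
  (≤-trans km<Σg (≤-trans (sum-mono {N} (λ t → g≤ΣF (toℕ t) (Fin.toℕ<n t)))
    (≤-reflexive (∑-comm {N} {k} (λ t a → F a (toℕ t))))))

-- A relation on natural numbers lets sums such as `t + δ + h` serve as coordinates; lying in the
-- grid is part of it.
At : ∀ {k n} → Coloring k n → ℕ → ℕ → Fin k → Set
At c x y a = ∃[ i ] ∃[ j ] (toℕ i ≡ x × toℕ j ≡ y × c i j ≡ a)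

At? : ∀ {k n} (c : Coloring k n) x y a → Dec (At c x y a)
At? c x y a = Fin.any? (λ i → Fin.any? (λ j →
  (toℕ i ≟ x) ×-dec (toℕ j ≟ y) ×-dec (c i j Fin.≟ a)))

At-total : ∀ {k n} (c : Coloring k n) {x y} → x < n → y < n → ∃[ a ] At c x y a
At-total c x<n y<n =
  _ , fromℕ< x<n , fromℕ< y<n , Fin.toℕ-fromℕ< x<n , Fin.toℕ-fromℕ< y<n , refl

At-row< : ∀ {k n} (c : Coloring k n) {x y a} → At c x y a → x < n
At-row< c (i , _ , refl , _) = Fin.toℕ<n i

At-col< : ∀ {k n} (c : Coloring k n) {x y a} → At c x y a → y < n
At-col< c (_ , j , _ , refl , _) = Fin.toℕ<n j

At⇒L : ∀ {k n} {c : Coloring k n} {x y x′ y′ a} d → 0 < d → x′ ≡ x + d → y′ ≡ y + d →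
       At c x y a → At c x′ y a → At c x′ y′ a → MonochromaticL c
At⇒L d 0<d x′≡ y′≡ (i , j , refl , refl , p) (i′ , j₁ , refl , eqj , q) (i₁ , j′ , eqi , refl , r)
  with refl ← Fin.toℕ-injective eqj | refl ← Fin.toℕ-injective eqi = record
  { x = i ; x′ = i′ ; y = j ; y′ = j′ ; d = d ; d-positive = 0<d ; x′≡x+d = x′≡ ; y′≡y+d = y′≡
  ; color₁₂ = trans p (sym q) ; color₂₃ = trans q (sym r) }

-- `punchIn r` lists the two colors other than r, and `punchIn b zero` is the index other than b, so
-- the right side is the one color left.
third-color : ∀ (r : Fin 3) (b : Fin 2) a → r ≢ a → punchIn r b ≢ a →
              a ≡ punchIn r (punchIn b zero)
third-color r b a r≢a b≢a
  with a′ ← punchOut r≢a | refl ← Fin.punchIn-punchOut r≢a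
  with punchOut {i = b} {j = a′} (b≢a ∘ cong (punchIn r))
     | Fin.punchIn-punchOut {i = b} {j = a′} (b≢a ∘ cong (punchIn r))
... | zero | refl = refl

-- Hooks and the L they force

-- The points t and t + h of the main diagonal have color r, and the point of the h-th
-- subdiagonal that completes them to an L has the b-th of the two other colors.
Hook : ∀ {n} → Coloring 3 n → Fin 3 → ℕ → Fin 2 → ℕ → Set
Hook c r h b t = At c t t r × At c (t + h) (t + h) r × At c (t + h) t (punchIn r b)

Hook? : ∀ {n} (c : Coloring 3 n) r h b t → Dec (Hook c r h b t)
Hook? c r h b t = At? c t t r ×-dec At? c (t + h) (t + h) r ×-dec At? c (t + h) t (punchIn r b)

-- The point closes an L of side δ + h with the diagonal points t and t + δ + h, of color r, and one
-- of side δ with the completing points of the two hooks, of the second color. Both colors are thus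
-- excluded.
hooks-force-third : ∀ {n} (c : Coloring 3 n) → ¬ MonochromaticL c → ∀ {r h b t δ} →
  0 < δ → Hook c r h b t → Hook c r h b (t + δ) →
  At c (t + δ + h) t (punchIn r (punchIn b zero))
hooks-force-third c noL {r} {h} {b} {t} {δ} 0<δ (tt-r , _ , b₁) (_ , uu-r , b₂)
  with a , at-a ← At-total c (At-row< c uu-r) (At-col< c tt-r)
  = subst (At c (t + δ + h) t) (third-color r b a
      (λ { refl → noL (At⇒L (δ + h) (≤-trans 0<δ (m≤m+n δ h)) (+-assoc t δ h) (+-assoc t δ h)
                             tt-r at-a uu-r) })
      (λ { refl → noL (At⇒L δ 0<δ (swap t δ h) refl b₁ at-a b₂) }))
      at-a
  where
  swap : ∀ t δ h → t + δ + h ≡ t + h + δ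
  swap = solve-∀

-- The pairs (t, t + d), (t, t + e + d) and (t + e, t + e + d) force the third color at (t + d + h,
-- t), (t + e + d + h, t) and (t + e + d + h, t + e), an L of side e.
no-repeated-difference : ∀ {n} (c : Coloring 3 n) → ¬ MonochromaticL c → ∀ {r h b t d e} →
  0 < d → 0 < e → Hook c r h b t → Hook c r h b (t + d) →
  Hook c r h b (t + e) → ¬ Hook c r h b (t + e + d)
no-repeated-difference c noL {r} {h} {b} {t} {d} {e} 0<d 0<e H₁ H₂ H₃ H₄ =
  noL (At⇒L e 0<e (swap t e d h) refl
    (hooks-force-third c noL 0<d H₁ H₂)
    (subst (λ u → At c (u + h) t (punchIn r (punchIn b zero))) (sym (+-assoc t e d))
      (hooks-force-third c noL (≤-trans 0<d (m≤n+m d e)) H₁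
        (subst (Hook c r h b) (+-assoc t e d) H₄)))
    (hooks-force-third c noL 0<d H₃ H₄))
  where
  swap : ∀ t e d h → t + e + d + h ≡ t + d + h + e
  swap = solve-∀

𝟙-product-positive : ∀ {P Q : Set} (P? : Dec P) (Q? : Dec Q) → 0 < 𝟙 P? * 𝟙 Q? → P × Q
𝟙-product-positive (yes p) (yes q) _ = p , q

𝟙-product≤ : ∀ {P Q : Set} (P? : Dec P) (Q? : Dec Q) {m} → (P → Q → 1 ≤ m) → 𝟙 P? * 𝟙 Q? ≤ m
𝟙-product≤ (no _)  Q?      _   = z≤n
𝟙-product≤ (yes _) (no _)  _   = z≤n
𝟙-product≤ (yes p) (yes q) 1≤m = 1≤m p q

same-color-pair⇒hook : ∀ {n} (c : Coloring 3 n) → ¬ MonochromaticL c → ∀ {r h} t → 0 < h →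
  At c t t r → At c (t + h) (t + h) r → ∃[ b ] Hook c r h b t
same-color-pair⇒hook c noL {r} {h} t 0<h at-t at-t+h
  with a , at-a ← At-total c (At-row< c at-t+h) (At-col< c at-t)
  = punchOut r≢a , at-t , at-t+h , subst (At c (t + h) t) (sym (Fin.punchIn-punchOut r≢a)) at-a
  where
  r≢a : r ≢ a
  r≢a refl = noL (At⇒L h 0<h refl refl at-t at-a at-t+h)

-- More than s diagonal points share a color, more than 2s′ of their pairs share a difference, and
-- more than s′ of the resulting hooks share a second color; the last inequality makes a difference
-- of these occur twice. Absence of an L is what limits the colors available, hence the double
-- negation.
L-unavoidable : ∀ N s v m s′ v′ m′ → 3 * s < N →
  (N + suc v) * (m * suc m) + suc v * (v * (2 * s′)) < 2 * m * (suc v * suc s) →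
  (N + suc v′) * (m′ * suc m′) + suc v′ * (v′ * 1) < 2 * m′ * (suc v′ * suc s′) →
  (c : Coloring 3 N) → ¬ ¬ MonochromaticL c
L-unavoidable N s v m s′ v′ m′ 3s<N gap gap′ c noL
  with r , many-r ← popular-class N 3 s (λ _ → 1) (λ a t → 𝟙 (At? c t t a))
         (λ t t<N → let a , at-a = At-total c t<N t<N in
           ≤-trans (𝟙-yes (At? c t t a) at-a) (term≤sum (λ a → 𝟙 (At? c t t a)) a))
         (subst (3 * s <_) (sym (trans (sum-const N 1) (*-identityʳ N))) 3s<N)
  with h , 0<h , many-h ← popular-difference N v m (2 * s′) (suc s) (λ t → 𝟙 (At? c t t r))
         (λ t → 𝟙≤1 (At? c t t r))
         (λ t N≤t → 𝟙-no (At? c t t r) (λ at → ≤⇒≯ N≤t (At-row< c at)))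
         many-r gap
  with b , many-b ← popular-class N 2 s′ (λ t → 𝟙 (At? c t t r) * 𝟙 (At? c (t + h) (t + h) r))
         (λ b t → 𝟙 (Hook? c r h b t))
         (λ t _ → 𝟙-product≤ (At? c t t r) (At? c (t + h) (t + h) r) (λ at-t at-t+h →
           let b , hook = same-color-pair⇒hook c noL t 0<h at-t at-t+h in
           ≤-trans (𝟙-yes (Hook? c r h b t) hook) (term≤sum (λ b → 𝟙 (Hook? c r h b t)) b)))
         many-h
  with d , 0<d , many-d ← popular-difference N v′ m′ 1 (suc s′) (λ t → 𝟙 (Hook? c r h b t))
         (λ t → 𝟙≤1 (Hook? c r h b t))
         (λ t N≤t → 𝟙-no (Hook? c r h b t) (λ hook → ≤⇒≯ N≤t (At-row< c (proj₁ hook))))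
         many-b gap′
  with t , e , 0<e , at-t , at-t+e ← two-positive N
         (λ t → 𝟙 (Hook? c r h b t) * 𝟙 (Hook? c r h b (t + d)))
         (λ t → *-mono-≤ (𝟙≤1 (Hook? c r h b t)) (𝟙≤1 (Hook? c r h b (t + d)))) many-d
  = let H₁ , H₂ = 𝟙-product-positive (Hook? c r h b t) (Hook? c r h b (t + d)) at-t
        H₃ , H₄ = 𝟙-product-positive (Hook? c r h b (t + e)) (Hook? c r h b (t + e + d)) at-t+e
    in no-repeated-difference c noL 0<d 0<e H₁ H₂ H₃ H₄

-- Decidability and the least n

-- The side must be x′ - x, which leaves a search over four indices.
MonochromaticL? : ∀ {k n} (c : Coloring k n) → Dec (MonochromaticL c)
MonochromaticL? c = map′
  (λ { (x , x′ , y , y′ , x<x′ , y′≡ , p , q) → record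
       { x = x ; x′ = x′ ; y = y ; y′ = y′ ; d = toℕ x′ ∸ toℕ x
       ; d-positive = m<n⇒0<n∸m x<x′ ; x′≡x+d = sym (m+[n∸m]≡n (<⇒≤ x<x′)) ; y′≡y+d = y′≡
       ; color₁₂ = p ; color₂₃ = q } })
  (λ l → let open MonochromaticL l
             d≡ = trans (sym (m+n∸m≡n (toℕ x) d)) (cong (_∸ toℕ x) (sym x′≡x+d))
         in x , x′ , y , y′
          , subst (toℕ x <_) (sym x′≡x+d) (m<m+n (toℕ x) d-positive)
          , trans y′≡y+d (cong (toℕ y +_) d≡) , color₁₂ , color₂₃)
  (Fin.any? λ x → Fin.any? λ x′ → Fin.any? λ y → Fin.any? λ y′ →
    (toℕ x <? toℕ x′) ×-dec (toℕ y′ ≟ toℕ y + (toℕ x′ ∸ toℕ x)) ×-dec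
    (c x y Fin.≟ c x′ y) ×-dec (c x′ y Fin.≟ c x′ y′))

MonochromaticL-cong : ∀ {k n} {c c′ : Coloring k n} → (∀ x y → c x y ≡ c′ x y) →
                      MonochromaticL c → MonochromaticL c′
MonochromaticL-cong c≗c′ l = record
  { MonochromaticL l
  ; color₁₂ = trans (sym (c≗c′ _ _)) (trans color₁₂ (c≗c′ _ _))
  ; color₂₃ = trans (sym (c≗c′ _ _)) (trans color₂₃ (c≗c′ _ _)) }
  where open MonochromaticL l

-- The colorings are encoded by (k^n)^n indices. Decoding returns a coloring pointwise, whence the
-- use of `MonochromaticL-cong`.
EveryColoringHasL? : ∀ k n → Dec (EveryColoringHasL k n)
EveryColoringHasL? k n = map′
  (λ hasL c → MonochromaticL-cong (decode-encode c) (hasL (encode c)))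
  (λ hasL i → hasL (decode i))
  (Fin.all? (λ i → MonochromaticL? (decode i)))
  where
  encode : Coloring k n → Fin ((k ^ n) ^ n)
  encode c = funToFin (λ x → funToFin (c x))
  decode : Fin ((k ^ n) ^ n) → Coloring k n
  decode i x = finToFun (finToFun i x)
  decode-encode : ∀ c x y → decode (encode c) x y ≡ c x y
  decode-encode c x y = trans
    (cong (λ i → finToFun i y) (Fin.finToFun-funToFin (λ x → funToFin (c x)) x))
    (Fin.finToFun-funToFin (c x) y)

least-witness : ∀ {P : ℕ → Set} → (∀ n → Dec (P n)) → ∀ n → P n →
                ∃[ m ] (P m × (∀ k → P k → m ≤ k) × m ≤ n)
least-witness P? zero    p = zero , p , (λ _ _ → z≤n) , z≤n
least-witness P? (suc n) p with P? zero
... | yes p₀ = zero , p₀ , (λ _ _ → z≤n) , z≤n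
... | no ¬p₀ with m , pₘ , least , m≤n ← least-witness (P? ∘ suc) n p =
  suc m , pₘ , (λ { zero p₀ → contradiction p₀ ¬p₀ ; (suc k) pₖ → s≤s (least k pₖ) }) , s≤s m≤n

EveryColoringHasL⇒0< : ∀ {k} n → EveryColoringHasL k n → 0 < n
EveryColoringHasL⇒0< zero    hasL with () ← MonochromaticL.x (hasL (λ ()))
EveryColoringHasL⇒0< (suc n) _    = z<s

R-exists-below : ∀ k N → EveryColoringHasL k N → ∃[ n ] (IsR k n × n ≤ N)
R-exists-below k N hasL =
  let n , hasLₙ , least , n≤N = least-witness (EveryColoringHasL? k) N hasL
  in n , record { positive = EveryColoringHasL⇒0< n hasLₙ ; forces = hasLₙ ; least = λ m _ → least m }
       , n≤N

theorem5 : ∃[ n ] (IsR 3 n × n ≤ 772)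
theorem5 = R-exists-below 3 772 (λ c → decidable-stable (MonochromaticL? c)
  -- 772 = 3 · 257 + 1. Windows of lengths 50 and 60 hold at least 12900/822 and 2340/832 points on
  -- average, whence 15 and 2; the gaps read 383480 < 387000 and 8532 < 9360.
  (L-unavoidable 772 257 49 15 38 59 2 (<ᵇ⇒< _ _ tt) (<ᵇ⇒< _ _ tt) (<ᵇ⇒< _ _ tt) c))
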